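{- Among the paths, $P_1$ and $P_3$ are the only dominating graphs of connected graphs. That is, for an integer $m\ge 1$, there exist a connected graph $G$ and a positive integer $k$ with $D_k(G)\cong P_m$ if and only if $m\in\{1,3\}$.
   Context: Graphs are finite and simple, with nonempty vertex set. $P_m$ denotes the path on $m$ vertices (so $P_1=K_1$). A set $S\subseteq V(G)$ is a dominating set of $G$ if every vertex in $V(G)\setminus S$ is adjacent to at least one vertex of $S$. For a positive integer $k$, the $k$-dominating graph $D_k(G)$ is the graph whose vertices are the dominating sets of $G$ of cardinality at most $k$, two of them being adjacent if and only if one is obtained from the other by adding or deleting a single vertex. A dominating graph of a connected graph is a graph isomorphic to $D_k(G)$ for some connected graph $G$ and some positive integer $k$. $\cong$ denotes graph isomorphism. -}

module Defs where

open import Data.Bool.Properties using (∨-identityʳ)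
open import Data.Fin.Base using (Fin; zero; suc; toℕ)
open import Data.Fin.Subset using (Subset; inside; outside; _∈_; _∉_; _∪_; _-_; ⁅_⁆; ∣_∣)
open import Data.Fin.Subset.Properties using (∪-identityʳ; p─⊥≡p; x∈p∪q⁺; x∈⁅x⁆)
open import Data.Nat.Base using (ℕ; suc; _≤_; NonZero)
open import Data.Nat.Properties using (_≟_; 1+n≢n)
open import Data.Product.Base using (∃-syntax; _×_; _,_)
open import Data.Sum.Base using (_⊎_; inj₁; inj₂)
open import Data.Vec.Base using (_∷_; here; there)
open import Function.Base using (_∘_)
open import Function.Bundles using (Inverse; _⇔_)
open import Level using (0ℓ)
open import Relation.Binary.Bundles using (Setoid)
open import Relation.Binary.Construct.Closure.ReflexiveTransitive using (Star)
import Relation.Binary.Construct.On as On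
open import Relation.Binary.Core using (Rel)
open import Relation.Binary.Definitions using (Symmetric; Decidable; _Respects₂_)
open import Relation.Binary.PropositionalEquality using (_≡_; refl; sym; trans; cong; cong₂; subst)
import Relation.Binary.PropositionalEquality as ≡
open import Relation.Nullary using (¬_; contradiction)
open import Relation.Nullary.Decidable using (_⊎-dec_)

-- Simple graphs on a setoid of vertices.  Setoid equality is needed because
-- a vertex of a dominating graph is a set bundled with proofs, and two such
-- bundles count as the same vertex when the underlying sets are equal.
record Graph : Set₁ where
  field
    vertices : Setoid 0ℓ 0ℓ
  open Setoid vertices public using (_≈_) renaming (Carrier to Vertex)
  field
    _~_    : Rel Vertex 0ℓ
    ~-resp : _~_ Respects₂ _≈_
    ~-sym  : Symmetric _~_
    ~-irr  : ∀ {u v} → u ≈ v → ¬ (u ~ v)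

infix 4 _≅_

record _≅_ (G H : Graph) : Set where
  private
    module G = Graph G
    module H = Graph H
  field
    bijection : Inverse G.vertices H.vertices
  open Inverse bijection public using (to; from)
  field
    adjacency : ∀ {u v} → (u G.~ v) ⇔ (to u H.~ to v)

-- Finite simple graphs with nonempty vertex set, which up to relabelling is
-- Fin n.  Adjacency is decidable, as a finite graph is given by an explicit
-- edge set.
record FiniteGraph : Set₁ where
  field
    order          : ℕ
    .order-nonZero : NonZero order
    _~_            : Rel (Fin order) 0ℓ
    _~?_           : Decidable _~_
    ~-sym          : Symmetric _~_
    ~-irr          : ∀ {v} → ¬ (v ~ v)

⟦_⟧ : FiniteGraph → Graph
⟦ G ⟧ = record
  { vertices = ≡.setoid (Fin order)
  ; _~_      = _~_
  ; ~-resp   = ≡.resp₂ _~_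
  ; ~-sym    = ~-sym
  ; ~-irr    = λ { refl → ~-irr }
  }
  where open FiniteGraph G

Connected : FiniteGraph → Set
Connected G = ∀ u v → Star _~_ u v
  where open FiniteGraph G

path : (m : ℕ) → .{{NonZero m}} → FiniteGraph
path m {{m≢0}} = record
  { order         = m
  ; order-nonZero = m≢0
  ; _~_           = λ i j → toℕ j ≡ suc (toℕ i) ⊎ toℕ i ≡ suc (toℕ j)
  ; _~?_          = λ i j → (toℕ j ≟ suc (toℕ i)) ⊎-dec (toℕ i ≟ suc (toℕ j))
  ; ~-sym         = λ { (inj₁ e) → inj₂ e ; (inj₂ e) → inj₁ e }
  ; ~-irr         = λ { (inj₁ e) → 1+n≢n (sym e) ; (inj₂ e) → 1+n≢n (sym e) }
  }

Dominating : (G : FiniteGraph) → Subset (FiniteGraph.order G) → Set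
Dominating G S = ∀ v → v ∉ S → ∃[ u ] (u ∈ S × v ~ u)
  where open FiniteGraph G

module _ {n : ℕ} where

  Adding Deleting AddingOrDeleting : Rel (Subset n) 0ℓ
  Adding           S T = ∃[ v ] (v ∉ S × T ≡ S ∪ ⁅ v ⁆)
  Deleting         S T = ∃[ v ] (v ∈ S × T ≡ S - v)
  AddingOrDeleting S T = Adding S T ⊎ Deleting S T

v∉S-v : ∀ {n} (S : Subset n) v → v ∉ S - v
v∉S-v (_ ∷ S) (suc v) (there v∈) = v∉S-v S v v∈

[S∪v]-v≡S : ∀ {n} (S : Subset n) v → v ∉ S → (S ∪ ⁅ v ⁆) - v ≡ S
[S∪v]-v≡S (inside  ∷ S) zero    v∉S = contradiction here v∉S
[S∪v]-v≡S (outside ∷ S) zero    v∉S = cong (outside ∷_) (trans (p─⊥≡p _) (∪-identityʳ S))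
[S∪v]-v≡S (x ∷ S)       (suc v) v∉S =
  cong₂ _∷_ (∨-identityʳ x) ([S∪v]-v≡S S v (v∉S ∘ there))

[S-v]∪v≡S : ∀ {n} (S : Subset n) v → v ∈ S → (S - v) ∪ ⁅ v ⁆ ≡ S
[S-v]∪v≡S (inside ∷ S) zero    here      = cong (inside ∷_) (trans (∪-identityʳ _) (p─⊥≡p S))
[S-v]∪v≡S (x ∷ S)      (suc v) (there v∈) =
  cong₂ _∷_ (∨-identityʳ x) ([S-v]∪v≡S S v v∈)

AddingOrDeleting-sym : ∀ {n} → Symmetric (AddingOrDeleting {n})
AddingOrDeleting-sym {x = S} (inj₁ (v , v∉S , refl)) =
  inj₂ (v , x∈p∪q⁺ (inj₂ (x∈⁅x⁆ v)) , sym ([S∪v]-v≡S S v v∉S))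
AddingOrDeleting-sym {x = S} (inj₂ (v , v∈S , refl)) =
  inj₁ (v , v∉S-v S v , sym ([S-v]∪v≡S S v v∈S))

AddingOrDeleting-irr : ∀ {n} {S : Subset n} → ¬ AddingOrDeleting S S
AddingOrDeleting-irr (inj₁ (v , v∉S , S≡)) =
  v∉S (subst (v ∈_) (sym S≡) (x∈p∪q⁺ (inj₂ (x∈⁅x⁆ v))))
AddingOrDeleting-irr {S = S} (inj₂ (v , v∈S , S≡)) =
  v∉S-v S v (subst (v ∈_) S≡ v∈S)

record DominatingSet (k : ℕ) (G : FiniteGraph) : Set where
  constructor mkDominatingSet
  field
    set        : Subset (FiniteGraph.order G)
    dominating : Dominating G set
    size≤k     : ∣ set ∣ ≤ k

open DominatingSet using (set)

D : ℕ → FiniteGraph → Graph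
D k G = record
  { vertices = On.setoid (≡.setoid (Subset (FiniteGraph.order G))) (set {k} {G})
  ; _~_      = λ S T → AddingOrDeleting (set S) (set T)
  ; ~-resp   = (λ {S} {T} {T′} e → subst (AddingOrDeleting (set S)) e)
             , (λ {T} {S} {S′} e → subst (λ R → AddingOrDeleting R (set T)) e)
  ; ~-sym    = AddingOrDeleting-sym
  ; ~-irr    = λ {S} {T} e a → AddingOrDeleting-irr (subst (AddingOrDeleting (set S)) (sym e) a)
  }

{-# OPTIONS --safe #-}

-- Let D_k(G) be a path on m ≥ 2 vertices, where G has order n ≥ 2, so that no
-- vertex of G is isolated.  If k ≥ n, then V is adjacent to every V - a, so n
-- = 2 and G = K₂.  If k < n, an end E of the path has k elements (otherwise
-- there are two ways to add a vertex), its neighbour is some E - v, and as E -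
-- v has at most two neighbours, E = V - x.  Now V - x is adjacent to V - x - y
-- exactly when xy is not a pendant edge, so every vertex y lies in a pair that
-- is not a pendant edge, and the ends V - x and V - z lie in only one such
-- pair each. A short case analysis of the neighbours of x and z shows that
-- this is impossible.

module Submission where

open import Defs
open import Data.Empty using (⊥-elim) renaming (⊥ to Empty)
open import Data.Fin.Base using (Fin; zero; suc; toℕ; fromℕ; inject₁)
open import Data.Fin.Permutation using (↔⇒≡)
open import Data.Fin.Properties
  using (_≟_; all?; ¬∀⟶∃¬; toℕ-injective; toℕ-fromℕ; toℕ-inject₁; toℕ<n; 0≢1+n)
open import Data.Fin.Subset
  using (Subset; inside; outside; _∈_; _∉_; _⊆_; _∪_; _-_; ⁅_⁆; ∣_∣; ⊤; ⊥)
open import Data.Fin.Subset.Properties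
  using (_∈?_; ∉⊥; ∣p∣≤n; ∈⊤; ∣⊤∣≡n; x∈⁅x⁆; x∈⁅y⁆⇒x≡y; ⊆-antisym; p⊆q⇒∣p∣≤∣q∣;
         p⊂q⇒∣p∣<∣q∣; p⊆p∪q; p─q⊆p; ∣p─q∣≤∣p∣; x∈p∪q⁻; x∈p∪q⁺; ∪-identityʳ;
         x∈p∧x≢y⇒x∈p-y; x∈p⇒∣p-x∣<∣p∣)
open import Data.Nat.Base
  using (ℕ; zero; suc; _≤_; _<_; _≥_; z≤n; s≤s; s≤s⁻¹; NonZero)
open import Data.Nat.Properties
  using (≤-refl; ≤-trans; <-≤-trans; <⇒≱; <⇒≢; ≤-<-connex;
         module ≤-Reasoning; suc-injective; m≤n⇒m≤1+n)
open import Data.Product.Base using (∃-syntax; _×_; _,_; proj₁; proj₂)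
open import Data.Sum.Base using (_⊎_; inj₁; inj₂; swap)
open import Data.Vec.Base using ([]; _∷_; here; there)
open import Function.Base using (_∘_)
open import Function.Bundles using (Inverse; Equivalence; _⇔_; mk⇔)
open import Function.Construct.Composition using (inverse)
open import Function.Construct.Symmetry using () renaming (inverse to inverse-sym)
open import Relation.Binary.Bundles using (Setoid)
open import Relation.Binary.Construct.Closure.ReflexiveTransitive using (ε; _◅_)
open import Relation.Binary.PropositionalEquality
  using (_≡_; _≢_; refl; sym; trans; cong; subst; subst₂; ≢-sym)
import Relation.Binary.PropositionalEquality as ≡
open import Relation.Nullary using (¬_; Dec; yes; no; contradiction)
open import Relation.Nullary.Decidable using (decidable-stable; _⊎-dec_; _→-dec_)

open DominatingSet

private
  variable
    n : ℕ

-- Sizes of subsets; insertion and deletion of single elements.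

∣S∪⁅v⁆∣≤1+∣S∣ : (S : Subset n) (v : Fin n) → ∣ S ∪ ⁅ v ⁆ ∣ ≤ suc ∣ S ∣
∣S∪⁅v⁆∣≤1+∣S∣ (inside  ∷ S) zero    rewrite ∪-identityʳ S = m≤n⇒m≤1+n ≤-refl
∣S∪⁅v⁆∣≤1+∣S∣ (outside ∷ S) zero    rewrite ∪-identityʳ S = ≤-refl
∣S∪⁅v⁆∣≤1+∣S∣ (inside  ∷ S) (suc v) = s≤s (∣S∪⁅v⁆∣≤1+∣S∣ S v)
∣S∪⁅v⁆∣≤1+∣S∣ (outside ∷ S) (suc v) = ∣S∪⁅v⁆∣≤1+∣S∣ S v

∣S∣<n⇒∃∉ : (S : Subset n) → ∣ S ∣ < n → ∃[ v ] v ∉ S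
∣S∣<n⇒∃∉ S ∣S∣<n = ¬∀⟶∃¬ _ (_∈ S) (_∈? S) λ all∈ →
  <⇒≱ ∣S∣<n (subst (_≤ ∣ S ∣) (∣⊤∣≡n _) (p⊆q⇒∣p∣≤∣q∣ {p = ⊤} {q = S} λ {x} _ → all∈ x))

n≤1+∣⊤-v∣ : (v : Fin n) → n ≤ suc ∣ ⊤ - v ∣
n≤1+∣⊤-v∣ {n} v = begin
  n                        ≡⟨ ∣⊤∣≡n n ⟨
  ∣ ⊤ {n} ∣                ≡⟨ cong ∣_∣ ([S-v]∪v≡S ⊤ v ∈⊤) ⟨
  ∣ (⊤ {n} - v) ∪ ⁅ v ⁆ ∣  ≤⟨ ∣S∪⁅v⁆∣≤1+∣S∣ (⊤ - v) v ⟩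
  suc ∣ ⊤ {n} - v ∣        ∎
  where open ≤-Reasoning

∣⊤-v∣<n : (v : Fin n) → ∣ ⊤ - v ∣ < n
∣⊤-v∣<n {n} v = subst (∣ ⊤ - v ∣ <_) (∣⊤∣≡n n) (x∈p⇒∣p-x∣<∣p∣ {x = v} {p = ⊤} ∈⊤)

∈-or-≡ : {S : Subset n} {u v : Fin n} → u ∉ S - v → u ∈ S → u ≡ v
∈-or-≡ {u = u} {v} u∉ u∈S = decidable-stable (u ≟ v) λ u≢v → u∉ (x∈p∧x≢y⇒x∈p-y u∈S u≢v)

∈-delete⇒≢ : {S : Subset n} {u v : Fin n} → u ∈ S - v → u ≢ v
∈-delete⇒≢ {S = S} {v = v} u∈ refl = v∉S-v S v u∈

∪⁅⁆-injective : {S : Subset n} {u v : Fin n} → u ∉ S → S ∪ ⁅ u ⁆ ≡ S ∪ ⁅ v ⁆ → u ≡ v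
∪⁅⁆-injective {S = S} {u} {v} u∉S eq
  with x∈p∪q⁻ S ⁅ v ⁆ (subst (u ∈_) eq (x∈p∪q⁺ (inj₂ (x∈⁅x⁆ u))))
... | inj₁ u∈S = contradiction u∈S u∉S
... | inj₂ u∈v = x∈⁅y⁆⇒x≡y v u∈v

delete-injective : {S : Subset n} {u v : Fin n} → u ∈ S → S - u ≡ S - v → u ≡ v
delete-injective {S = S} {u} u∈S eq = ∈-or-≡ (v∉S-v S u ∘ subst (u ∈_) (sym eq)) u∈S

-- Degrees and ends in paths, transported to graphs isomorphic to a path.

module _ (m : ℕ) where

  open FiniteGraph (path (suc (suc m)))

  path-neighbour : ∀ i → ∃[ j ] i ~ j
  path-neighbour zero    = suc zero , inj₁ refl
  path-neighbour (suc i) = inject₁ i , inj₂ (cong suc (sym (toℕ-inject₁ i)))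

  path-zero-end : ∀ {i j} → zero ~ i → zero ~ j → i ≡ j
  path-zero-end (inj₁ p) (inj₁ q) = toℕ-injective (trans p (sym q))

  path-last-end : ∀ {i j} → fromℕ (suc m) ~ i → fromℕ (suc m) ~ j → i ≡ j
  path-last-end {i} {j} p q = toℕ-injective (suc-injective (trans (sym (below i p)) (below j q)))
    where
    below : ∀ i → fromℕ (suc m) ~ i → toℕ (fromℕ (suc m)) ≡ suc (toℕ i)
    below i (inj₁ p) = contradiction (trans p (cong suc (toℕ-fromℕ (suc m)))) (<⇒≢ (toℕ<n i))
    below i (inj₂ p) = p

  -- Each neighbour sits directly above or directly below `h`, so two of the three lie on the same
  -- side and coincide.
  path-three-neighbours : ∀ {h i j l} → h ~ i → h ~ j → h ~ l → i ≡ j ⊎ i ≡ l ⊎ j ≡ l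
  path-three-neighbours {h} = go
    where
    above : ∀ {i j} → toℕ i ≡ suc (toℕ h) → toℕ j ≡ suc (toℕ h) → i ≡ j
    above p q = toℕ-injective (trans p (sym q))
    below : ∀ {i j} → toℕ h ≡ suc (toℕ i) → toℕ h ≡ suc (toℕ j) → i ≡ j
    below p q = toℕ-injective (suc-injective (trans (sym p) q))
    go : ∀ {i j l} → h ~ i → h ~ j → h ~ l → i ≡ j ⊎ i ≡ l ⊎ j ≡ l
    go (inj₁ p) (inj₁ q) _        = inj₁ (above p q)
    go (inj₁ p) (inj₂ _) (inj₁ r) = inj₂ (inj₁ (above p r))
    go (inj₁ _) (inj₂ q) (inj₂ r) = inj₂ (inj₂ (below q r))
    go (inj₂ _) (inj₁ q) (inj₁ r) = inj₂ (inj₂ (above q r))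
    go (inj₂ p) (inj₁ _) (inj₂ r) = inj₂ (inj₁ (below p r))
    go (inj₂ p) (inj₂ q) _        = inj₁ (below p q)

module PathShaped (H : Graph) (m : ℕ) (iso : H ≅ ⟦ path (suc (suc m)) ⟧) where

  open Graph H
  open FiniteGraph (path (suc (suc m))) using () renaming (_~_ to _~ₚ_)
  open _≅_ iso using (bijection; to; from; adjacency)
  open Inverse bijection using (inverseˡ; inverseʳ; strictlyInverseˡ)

  -- Only the upper bound on the degree is recorded; the lower bound comes from `neighbour`.
  IsEnd : Vertex → Set
  IsEnd S = ∀ A B → S ~ A → S ~ B → A ≈ B

  private
    to-injective : ∀ {A B} → to A ≡ to B → A ≈ B
    to-injective {A} {B} eq = ≈-trans (≈-sym (inverseʳ refl)) (inverseʳ eq)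
      where open Setoid vertices using () renaming (trans to ≈-trans; sym to ≈-sym)

    to~ : ∀ {A B} → A ~ B → to A ~ₚ to B
    to~ = Equivalence.to adjacency

    from~ : ∀ i {A} → from i ~ A → i ~ₚ to A
    from~ i p = subst (_~ₚ _) (strictlyInverseˡ _) (to~ p)

  neighbour : ∀ A → ∃[ B ] A ~ B
  neighbour A with j , i~j ← path-neighbour m (to A) =
    from j , Equivalence.from adjacency
      (subst (to A ~ₚ_) (sym (strictlyInverseˡ _)) i~j)

  three-neighbours : ∀ S A B C → S ~ A → S ~ B → S ~ C → A ≈ B ⊎ A ≈ C ⊎ B ≈ C
  three-neighbours _ _ _ _ a b c with path-three-neighbours m (to~ a) (to~ b) (to~ c)
  ... | inj₁ e        = inj₁ (to-injective e)
  ... | inj₂ (inj₁ e) = inj₂ (inj₁ (to-injective e))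
  ... | inj₂ (inj₂ e) = inj₂ (inj₂ (to-injective e))

  first last : Vertex
  first = from zero
  last  = from (fromℕ (suc m))

  first-isEnd : IsEnd first
  first-isEnd _ _ a b = to-injective (path-zero-end m (from~ zero a) (from~ zero b))

  last-isEnd : IsEnd last
  last-isEnd _ _ a b = to-injective (path-last-end m (from~ _ a) (from~ _ b))

  first≉last : ¬ first ≈ last
  first≉last e = 0≢1+n (trans (sym (strictlyInverseˡ _)) (inverseˡ e))

-- Pendant edges in graphs without isolated vertices.

NoIsolated : FiniteGraph → Set
NoIsolated G = ∀ v → ∃[ u ] v ~ u
  where open FiniteGraph G

distinct-from : 2 ≤ n → (v : Fin n) → ∃[ u ] v ≢ u
distinct-from (s≤s (s≤s _)) zero    = suc zero , λ ()
distinct-from (s≤s (s≤s _)) (suc _) = zero , λ ()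

three-distinct : 3 ≤ n → ∃[ a ] ∃[ b ] ∃[ c ] (_≢_ {A = Fin n} a b × a ≢ c × b ≢ c)
three-distinct (s≤s (s≤s (s≤s _))) = zero , suc zero , suc (suc zero) , (λ ()) , (λ ()) , (λ ())

-- A walk from `v` to some other vertex has a first step.
connected⇒noIsolated : ∀ G → Connected G → 2 ≤ FiniteGraph.order G → NoIsolated G
connected⇒noIsolated G connected 2≤n v with u , v≢u ← distinct-from 2≤n v with connected v u
... | ε       = contradiction refl v≢u
... | v~w ◅ _ = _ , v~w

module Pendants (G : FiniteGraph) (noIsolated : NoIsolated G) where

  open FiniteGraph G

  private
    variable
      u v w x y z : Fin order

  -- x is a leaf attached to y, given that x is not isolated.
  Leaf : Fin order → Fin order → Set
  Leaf x y = ∀ u → x ~ u → u ≡ y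

  -- By `leaf-adjacent`, such a pair is an edge with an end of degree one.
  Pendant : Fin order → Fin order → Set
  Pendant x y = Leaf x y ⊎ Leaf y x

  leaf? : ∀ x y → Dec (Leaf x y)
  leaf? x y = all? λ u → (x ~? u) →-dec (u ≟ y)

  pendant? : ∀ x y → Dec (Pendant x y)
  pendant? x y = leaf? x y ⊎-dec leaf? y x

  leaf-adjacent : Leaf x y → x ~ y
  leaf-adjacent {x} leaf with u , x~u ← noIsolated x = subst (x ~_) (leaf u x~u) x~u

  leaf-unique : Leaf x y → Leaf x z → y ≡ z
  leaf-unique xy xz = xz _ (leaf-adjacent xy)

  leaf-leaf : Leaf x y → Leaf y z → x ≡ z
  leaf-leaf xy yz = yz _ (~-sym (leaf-adjacent xy))

  ¬leaf⇒∃ : ¬ Leaf x y → ∃[ u ] (x ~ u × u ≢ y)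
  ¬leaf⇒∃ {x} {y} ¬leaf
    with u , ¬imp ← ¬∀⟶∃¬ order _ (λ u → (x ~? u) →-dec (u ≟ y)) ¬leaf
    with x ~? u
  ... | yes x~u = u , x~u , λ u≡y → ¬imp λ _ → u≡y
  ... | no ¬x~u = contradiction (λ x~u → contradiction x~u ¬x~u) ¬imp

  -- This is what remains of `⊤ - x` being an end of the path: its deletions `⊤ - x - a` dominate
  -- exactly when the pair is not pendant.
  AtMostOneNonPendant : Fin order → Set
  AtMostOneNonPendant x = ∀ {a b} → a ≢ x → b ≢ x → ¬ Pendant x a → ¬ Pendant x b → a ≡ b

  private
    -- Since `v` is not a leaf at `x`, it has a neighbour `u` other than `x`. The only pendant pair
    -- at the leaf `z` is the one with `x`, so `u` and `v` are both non-pendant partners of `z`.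
    -- Hence they coincide, and `v` is adjacent to itself.
    leaf-impossible : AtMostOneNonPendant z → Leaf z x → v ≢ x → v ≢ z → ¬ Leaf v x → Empty
    leaf-impossible {z} {x} {v} endz zx v≢x v≢z ¬vx
      with u , v~u , u≢x ← ¬leaf⇒∃ ¬vx =
      ~-irr (subst (v ~_) u≡v v~u)
      where
      nonPendant : ∀ {y} → y ≢ x → ¬ Pendant z y
      nonPendant y≢x (inj₁ zy) = y≢x (leaf-unique zy zx)
      nonPendant y≢x (inj₂ yz) = y≢x (leaf-leaf yz zx)
      u≢z : u ≢ z
      u≢z refl = v≢x (zx v (~-sym v~u))
      u≡v : u ≡ v
      u≡v = endz u≢z v≢z (nonPendant u≢x) (nonPendant v≢x)

  module _ (partner : ∀ y → ∃[ t ] (t ≢ y × ¬ Pendant y t)) where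

    private
      -- As `z` is the one non-pendant partner of `x` and conversely, every other vertex `y` forms
      -- pendant pairs with both. Since `x` and `z` differ, this forces both to be leaves at `y`.
      -- This applies to a neighbour `u` of `x` and also to the partner `t` of `u`, so `x` is a leaf
      -- at both and `t` equals `u`.
      nonPendant-impossible : AtMostOneNonPendant x → AtMostOneNonPendant z →
                              x ≢ z → ¬ Pendant x z → Empty
      nonPendant-impossible {x} {z} endx endz x≢z ¬xz
        with u , x~u , u≢z ← ¬leaf⇒∃ (¬xz ∘ inj₁)
        with t , t≢u , ¬ut ← partner u = t≢u (leaf-unique (proj₁ (leaves t≢x t≢z)) (proj₁ uLeaves))
        where
        leaves : ∀ {y} → y ≢ x → y ≢ z → Leaf x y × Leaf z y
        leaves {y} y≢x y≢z
          with decidable-stable (pendant? x y) (λ ¬xy → y≢z (endx y≢x (≢-sym x≢z) ¬xy ¬xz))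
             | decidable-stable (pendant? z y) (λ ¬zy → y≢x (endz y≢z x≢z ¬zy (¬xz ∘ swap)))
        ... | inj₁ xy | inj₁ zy = xy , zy
        ... | inj₁ xy | inj₂ yz = contradiction (leaf-leaf xy yz) x≢z
        ... | inj₂ yx | inj₁ zy = contradiction (sym (leaf-leaf zy yx)) x≢z
        ... | inj₂ yx | inj₂ yz = contradiction (leaf-unique yx yz) x≢z
        u≢x : u ≢ x
        u≢x refl = ~-irr x~u
        uLeaves = leaves u≢x u≢z
        t≢x : t ≢ x
        t≢x refl = ¬ut (inj₂ (proj₁ uLeaves))
        t≢z : t ≢ z
        t≢z refl = ¬ut (inj₂ (proj₂ uLeaves))

    two-ends-impossible : AtMostOneNonPendant x → AtMostOneNonPendant z → x ≢ z → Empty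
    two-ends-impossible {x} {z} endx endz x≢z with pendant? x z
    ... | no ¬xz = nonPendant-impossible endx endz x≢z ¬xz
    -- The partner `w` of `z` is not a leaf at `z`, hence also differs from the leaf `x`; this is
    -- the vertex that `leaf-impossible` needs.
    ... | yes (inj₁ xz) with w , w≢z , ¬zw ← partner z =
      leaf-impossible endx xz w≢z (λ { refl → ¬zw (inj₂ xz) }) (¬zw ∘ inj₂)
    ... | yes (inj₂ zx) with v , v≢x , ¬xv ← partner x =
      leaf-impossible endz zx v≢x (λ { refl → ¬xv (inj₂ zx) }) (¬xv ∘ inj₂)

  dominating-⊤-v : ∀ v → Dominating G (⊤ - v)
  dominating-⊤-v v u u∉ with refl ← ∈-or-≡ {S = ⊤} u∉ ∈⊤ | w , v~w ← noIsolated v =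
    w , x∈p∧x≢y⇒x∈p-y ∈⊤ (λ { refl → ~-irr v~w }) , v~w

  -- A leaf of the pair lies outside the set together with its only neighbour.
  dominating⇒¬pendant : Dominating G (⊤ - x - y) → ¬ Pendant x y
  dominating⇒¬pendant {x} {y} dom (inj₁ xy)
    with u , u∈ , x~u ← dom x (v∉S-v ⊤ x ∘ p─q⊆p (⊤ - x) ⁅ y ⁆) = ∈-delete⇒≢ u∈ (xy u x~u)
  dominating⇒¬pendant {x} {y} dom (inj₂ yx)
    with u , u∈ , y~u ← dom y (v∉S-v (⊤ - x) y) =
    ∈-delete⇒≢ (p─q⊆p (⊤ - x) ⁅ y ⁆ u∈) (yx u y~u)

  -- Only `x` and `y` need to be dominated, and each has a neighbour other than the other one.
  ¬pendant⇒dominating : ¬ Pendant x y → Dominating G (⊤ - x - y)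
  ¬pendant⇒dominating {x} {y} ¬xy v v∉ with v ≟ x
  ... | yes refl with u , x~u , u≢y ← ¬leaf⇒∃ (¬xy ∘ inj₁) =
    u , x∈p∧x≢y⇒x∈p-y (x∈p∧x≢y⇒x∈p-y ∈⊤ λ { refl → ~-irr x~u }) u≢y , x~u
  ... | no v≢x with refl ← ∈-or-≡ {S = ⊤ - x} v∉ (x∈p∧x≢y⇒x∈p-y ∈⊤ v≢x)
               with u , y~u , u≢x ← ¬leaf⇒∃ (¬xy ∘ inj₂) =
    u , x∈p∧x≢y⇒x∈p-y (x∈p∧x≢y⇒x∈p-y ∈⊤ u≢x) (λ { refl → ~-irr y~u }) , y~u


-- Dominating graphs that are paths: the case `k < order`.

dominating-mono : ∀ G {S T} → S ⊆ T → Dominating G S → Dominating G T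
dominating-mono G S⊆T dom v v∉T with u , u∈S , v~u ← dom v (v∉T ∘ S⊆T) = u , S⊆T u∈S , v~u

module _ (k : ℕ) (G : FiniteGraph) (noIsolated : NoIsolated G)
         (m : ℕ) (iso : D k G ≅ ⟦ path (suc (suc m)) ⟧) where

  open FiniteGraph G using (order)
  open Graph (D k G) using (_~_)
  open Pendants G noIsolated
  open PathShaped (D k G) m iso

  module _ (k<n : k < order) where

    private
      add : (S : DominatingSet k G) → ∣ set S ∣ < k → Fin order → DominatingSet k G
      add S lt v = mkDominatingSet (set S ∪ ⁅ v ⁆)
        (dominating-mono G (p⊆p∪q ⁅ v ⁆) (dominating S))
        (≤-trans (∣S∪⁅v⁆∣≤1+∣S∣ (set S) v) lt)

      -- With fewer than `k` elements, `set S` misses two vertices, and adding either one gives a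
      -- neighbour.
      end-full : ∀ S → IsEnd S → ¬ (∣ set S ∣ < k)
      end-full S end lt
        with x , x∉S ← ∣S∣<n⇒∃∉ (set S) (≤-trans lt (≤-trans (m≤n⇒m≤1+n ≤-refl) k<n))
        -- The enlarged set still has at most `k < order` elements; taking `y` outside it keeps `y`
        -- distinct from `x`.
        with y , y∉  ← ∣S∣<n⇒∃∉ (set S ∪ ⁅ x ⁆) (≤-trans (s≤s (size≤k (add S lt x))) k<n)
        with refl ← ∪⁅⁆-injective {S = set S} x∉S
               (end (add S lt x) (add S lt y) (inj₁ (x , x∉S , refl)) (inj₁ (y , y∉ ∘ p⊆p∪q ⁅ x ⁆ , refl)))
        = y∉ (x∈p∪q⁺ (inj₂ (x∈⁅x⁆ x)))

      -- A neighbour obtained by an addition would leave `set S` with fewer than `k` elements,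
      -- against `end-full`.
      end-delete : ∀ S → IsEnd S → ∃[ v ] (v ∈ set S × Dominating G (set S - v))
      end-delete S end with neighbour S
      ... | T , inj₂ (v , v∈S , refl) = v , v∈S , dominating T
      ... | T , inj₁ (v , v∉S , refl) = contradiction
        (<-≤-trans (p⊂q⇒∣p∣<∣q∣ (p⊆p∪q ⁅ v ⁆ , v , x∈p∪q⁺ (inj₂ (x∈⁅x⁆ v)) , v∉S)) (size≤k T))
        (end-full S end)

      -- The set `T`, which is `set S - v`, has room for one more vertex. Adding back `v`, or adding
      -- any vertex outside `set S`, gives a neighbour of `T`. There are at most two neighbours, so
      -- only one vertex can lie outside `set S`.
      end-shape : ∀ S → IsEnd S → ∃[ x ] set S ≡ ⊤ - x
      end-shape S end
        with x , x∉S ← ∣S∣<n⇒∃∉ (set S) (≤-trans (s≤s (size≤k S)) k<n)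
        with v , v∈S , dom ← end-delete S end =
        x , ⊆-antisym (λ u∈S → x∈p∧x≢y⇒x∈p-y ∈⊤ λ { refl → x∉S u∈S })
                      (λ {u} u∈ → decidable-stable (u ∈? set S) λ u∉S → ∈-delete⇒≢ u∈ (only u∉S))
        where
        T : DominatingSet k G
        T = mkDominatingSet (set S - v) dom (≤-trans (∣p─q∣≤∣p∣ (set S) ⁅ v ⁆) (size≤k S))
        lt : ∣ set T ∣ < k
        lt = <-≤-trans (x∈p⇒∣p-x∣<∣p∣ v∈S) (size≤k S)
        ∉T : ∀ {u} → u ∉ set S → u ∉ set T
        ∉T u∉S = u∉S ∘ p─q⊆p (set S) ⁅ v ⁆
        v∉T : v ∉ set T
        v∉T = v∉S-v (set S) v
        T~add : ∀ {u} → u ∉ set T → T ~ add T lt u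
        T~add u∉T = inj₁ (_ , u∉T , refl)
        only : ∀ {u} → u ∉ set S → u ≡ x
        only {u} u∉S
          with three-neighbours T (add T lt u) (add T lt x) (add T lt v)
                 (T~add (∉T u∉S)) (T~add (∉T x∉S)) (T~add v∉T)
        ... | inj₁ e = ∪⁅⁆-injective (∉T u∉S) e
        ... | inj₂ (inj₁ e) with refl ← ∪⁅⁆-injective (∉T u∉S) e = contradiction v∈S u∉S
        ... | inj₂ (inj₂ e) with refl ← ∪⁅⁆-injective (∉T x∉S) e = contradiction v∈S x∉S

      -- The end `first` has the form `⊤ - x`, and its size is at most `k`. This leaves room for
      -- every `⊤ - y` as a vertex of `D k G`.
      order≤1+k : order ≤ suc k
      order≤1+k with x , eq ← end-shape first first-isEnd =
        ≤-trans (n≤1+∣⊤-v∣ x) (s≤s (subst (λ S → ∣ S ∣ ≤ k) eq (size≤k first)))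

      ∣⊤-y∣≤k : ∀ y → ∣ ⊤ - y ∣ ≤ k
      ∣⊤-y∣≤k y = s≤s⁻¹ (≤-trans (∣⊤-v∣<n y) order≤1+k)

      partner : ∀ y → ∃[ t ] (t ≢ y × ¬ Pendant y t)
      partner y with neighbour (mkDominatingSet (⊤ - y) (dominating-⊤-v y) (∣⊤-y∣≤k y))
      ... | T , inj₂ (t , t∈ , refl) = t , ∈-delete⇒≢ t∈ , dominating⇒¬pendant (dominating T)
      -- Only `y` itself can be added to `⊤ - y`, and the resulting `⊤` exceeds the size bound.
      ... | T , inj₁ (t , t∉ , T≡) with refl ← ∈-or-≡ {S = ⊤} t∉ ∈⊤ = contradiction order≤k (<⇒≱ k<n)
        where
        open ≤-Reasoning
        order≤k : order ≤ k
        order≤k = begin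
          order                ≡⟨ ∣⊤∣≡n order ⟨
          ∣ ⊤ {order} ∣        ≡⟨ cong ∣_∣ ([S-v]∪v≡S ⊤ t ∈⊤) ⟨
          ∣ (⊤ - t) ∪ ⁅ t ⁆ ∣  ≡⟨ cong ∣_∣ T≡ ⟨
          ∣ set T ∣            ≤⟨ size≤k T ⟩
          k                    ∎

      end⇒atMostOne : ∀ S → IsEnd S → ∀ {x} → set S ≡ ⊤ - x → AtMostOneNonPendant x
      end⇒atMostOne S end {x} eq a≢x b≢x ¬xa ¬xb =
        delete-injective (x∈p∧x≢y⇒x∈p-y ∈⊤ a≢x)
          (end (pair ¬xa) (pair ¬xb) (S~pair a≢x ¬xa) (S~pair b≢x ¬xb))
        where
        pair : ∀ {y} → ¬ Pendant x y → DominatingSet k G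
        pair {y} ¬xy = mkDominatingSet (⊤ - x - y) (¬pendant⇒dominating ¬xy)
          (≤-trans (∣p─q∣≤∣p∣ (⊤ - x) ⁅ y ⁆) (∣⊤-y∣≤k x))
        S~pair : ∀ {y} (y≢x : y ≢ x) (¬xy : ¬ Pendant x y) → S ~ pair ¬xy
        S~pair y≢x _ = inj₂
          (_ , subst (_ ∈_) (sym eq) (x∈p∧x≢y⇒x∈p-y ∈⊤ y≢x) , cong (_- _) (sym eq))

    k<order-impossible : Empty
    k<order-impossible
      with x , eqx ← end-shape first first-isEnd
      with z , eqz ← end-shape last last-isEnd =
      two-ends-impossible partner
        (end⇒atMostOne first first-isEnd eqx) (end⇒atMostOne last last-isEnd eqz)
        (λ x≡z → first≉last (trans eqx (trans (cong (⊤ -_) x≡z) (sym eqz))))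

  -- The case `order ≤ k`.

  module _ (n≤k : order ≤ k) where

    -- Otherwise `⊤` would have three distinct neighbours in the path, one for each deleted vertex.
    no-three-vertices : ∀ {a b c : Fin order} → a ≢ b → a ≢ c → b ≢ c → Empty
    no-three-vertices {a} {b} {c} a≢b a≢c b≢c
      with three-neighbours top (minus a) (minus b) (minus c) (top~ a) (top~ b) (top~ c)
      where
      size : (S : Subset order) → ∣ S ∣ ≤ k
      size S = ≤-trans (∣p∣≤n S) n≤k
      top : DominatingSet k G
      top = mkDominatingSet ⊤ (λ v v∉⊤ → contradiction ∈⊤ v∉⊤) (size ⊤)
      minus : Fin order → DominatingSet k G
      minus v = mkDominatingSet (⊤ - v) (dominating-⊤-v v) (size (⊤ - v))
      top~ : ∀ v → top ~ minus v
      top~ v = inj₂ (v , ∈⊤ , refl)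
    ... | inj₁ e        = a≢b (delete-injective ∈⊤ e)
    ... | inj₂ (inj₁ e) = a≢c (delete-injective ∈⊤ e)
    ... | inj₂ (inj₂ e) = b≢c (delete-injective ∈⊤ e)

-- Dominating sets of graphs of order 1 and 2.

order-1-vertices : ∀ k G → FiniteGraph.order G ≡ 1 → k ≥ 1 →
                   Inverse (Graph.vertices (D k G)) (≡.setoid (Fin 1))
order-1-vertices k G@record { order = 1 } refl k≥1 = record
  { to        = λ _ → zero
  ; from      = λ _ → whole
  ; to-cong   = λ _ → refl
  ; from-cong = λ _ → refl
  ; inverse   = (λ { {zero} _ → refl }) , λ {S} _ → sym (unique S)
  }
  where
  whole : DominatingSet k G
  whole = mkDominatingSet ⊤ (λ v v∉⊤ → contradiction ∈⊤ v∉⊤) k≥1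
  unique : (S : DominatingSet k G) → set S ≡ ⊤
  unique (mkDominatingSet (inside  ∷ []) _   _) = refl
  unique (mkDominatingSet (outside ∷ []) dom _) with zero , () , _ ← dom zero (λ ())

-- The empty set gets a junk value.
code : Subset 2 → Fin 3
code (inside  ∷ outside ∷ []) = zero
code (inside  ∷ inside  ∷ []) = suc zero
code (outside ∷ inside  ∷ []) = suc (suc zero)
code (outside ∷ outside ∷ []) = zero

-- Consecutive sets in this order differ by one vertex, so indices are positions along the path.
-- Singletons are written as deletions so that `dominating-⊤-v` applies.
decode : Fin 3 → Subset 2
decode zero             = ⊤ - suc zero
decode (suc zero)       = ⊤
decode (suc (suc zero)) = ⊤ - zero

code-decode : ∀ i → code (decode i) ≡ i
code-decode zero             = refl
code-decode (suc zero)       = refl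
code-decode (suc (suc zero)) = refl

decode-code : ∀ {S} → S ≢ ⊥ → decode (code S) ≡ S
decode-code {inside  ∷ inside  ∷ []} _   = refl
decode-code {inside  ∷ outside ∷ []} _   = refl
decode-code {outside ∷ inside  ∷ []} _   = refl
decode-code {outside ∷ outside ∷ []} S≢⊥ = contradiction refl S≢⊥

dominating⇒≢⊥ : ∀ G {S} → Fin (FiniteGraph.order G) → Dominating G S → S ≢ ⊥
dominating⇒≢⊥ G v dom refl with u , u∈⊥ , _ ← dom v ∉⊥ = ∉⊥ u∈⊥

-- All three nonempty subsets dominate, the singletons because no vertex is isolated. Adjacency is
-- left out: the count suffices to find the length of the path.
order-2-vertices : ∀ k G → NoIsolated G → FiniteGraph.order G ≡ 2 → k ≥ 2 →
                   Inverse (Graph.vertices (D k G)) (≡.setoid (Fin 3))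
order-2-vertices k G@record { order = 2 } noIsolated refl k≥2 = record
  { to        = code ∘ set
  ; from      = λ i → mkDominatingSet (decode i) (dominating-decode i) (≤-trans (∣p∣≤n (decode i)) k≥2)
  ; to-cong   = cong code
  ; from-cong = cong decode
  ; inverse   = (λ {i} e → trans (cong code e) (code-decode i))
              , (λ {S} e → trans (cong decode e) (decode-code (dominating⇒≢⊥ G zero (dominating S))))
  }
  where
  open Pendants G noIsolated using (dominating-⊤-v)
  dominating-decode : ∀ i → Dominating G (decode i)
  dominating-decode zero             = dominating-⊤-v (suc zero)
  dominating-decode (suc zero)       = λ v v∉⊤ → contradiction ∈⊤ v∉⊤
  dominating-decode (suc (suc zero)) = dominating-⊤-v zero

-- The two realisations, from `path 1` and `path 2`.

path-1-connected : Connected (path 1)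
path-1-connected zero zero = ε

path-2-connected : Connected (path 2)
path-2-connected zero       zero       = ε
path-2-connected zero       (suc zero) = inj₁ refl ◅ ε
path-2-connected (suc zero) zero       = inj₂ refl ◅ ε
path-2-connected (suc zero) (suc zero) = ε

D₁K₁≅P₁ : D 1 (path 1) ≅ ⟦ path 1 ⟧
D₁K₁≅P₁ = record
  { bijection = bijection
  ; adjacency = λ {S} {T} → mk⇔
      -- All dominating sets here coincide, so irreflexivity excludes adjacency.
      (λ S~T → contradiction S~T (Graph.~-irr (D 1 (path 1)) {S} {T}
        (trans (sym (strictlyInverseʳ S)) (strictlyInverseʳ T))))
      (λ z~z → contradiction z~z (FiniteGraph.~-irr (path 1) {zero}))
  }
  where
  bijection = order-1-vertices 1 (path 1) refl ≤-refl
  open Inverse bijection using (strictlyInverseʳ)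

D₂K₂≅P₃ : D 2 (path 2) ≅ ⟦ path 3 ⟧
D₂K₂≅P₃ = record
  { bijection = order-2-vertices 2 (path 2) (connected⇒noIsolated (path 2) path-2-connected ≤-refl) refl ≤-refl
  ; adjacency = λ {S} {T} → mk⇔ (forward {set S} {set T} (≢⊥ S) (≢⊥ T))
      (subst₂ AddingOrDeleting (decode-code (≢⊥ S)) (decode-code (≢⊥ T)) ∘ backward _ _)
  }
  where
  open FiniteGraph (path 3) using (_~_; ~-sym)

  ≢⊥ : (S : DominatingSet 2 (path 2)) → set S ≢ ⊥
  ≢⊥ S = dominating⇒≢⊥ (path 2) zero (dominating S)

  adding : ∀ {S T} → S ≢ ⊥ → Adding S T → code S ~ code T
  adding {inside  ∷ outside ∷ []} _   (suc zero , _   , refl) = inj₁ refl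
  adding {outside ∷ inside  ∷ []} _   (zero     , _   , refl) = inj₂ refl
  adding {inside  ∷ _       ∷ []} _   (zero     , v∉S , _)    = contradiction here v∉S
  adding {_       ∷ inside  ∷ []} _   (suc zero , v∉S , _)    = contradiction (there here) v∉S
  adding {outside ∷ outside ∷ []} S≢⊥ _                       = contradiction refl S≢⊥

  forward : ∀ {S T} → S ≢ ⊥ → T ≢ ⊥ → AddingOrDeleting S T → code S ~ code T
  forward {S} {T} S≢⊥ T≢⊥ (inj₁ add) = adding {S} {T} S≢⊥ add
  forward {S} S≢⊥ T≢⊥ (inj₂ (v , v∈S , refl)) =
    -- A deletion is an addition read backwards; `T≢⊥` keeps the smaller set nonempty.
    ~-sym {code (S - v)} {code S} (adding {S - v} {S} T≢⊥ (v , v∉S-v S v , sym ([S-v]∪v≡S S v v∈S)))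

  backward : ∀ i j → i ~ j → AddingOrDeleting (decode i) (decode j)
  backward zero             (suc zero)       _ = inj₁ (suc zero , (λ { (there ()) }) , refl)
  backward (suc (suc zero)) (suc zero)       _ = inj₁ (zero , (λ ()) , refl)
  backward (suc zero)       zero             _ = inj₂ (suc zero , there here , refl)
  backward (suc zero)       (suc (suc zero)) _ = inj₂ (zero , here , refl)
  backward zero             zero             p = contradiction p (FiniteGraph.~-irr (path 3) {zero})
  backward (suc zero)       (suc zero)       p = contradiction p (FiniteGraph.~-irr (path 3) {suc zero})
  backward (suc (suc zero)) (suc (suc zero)) p = contradiction p (FiniteGraph.~-irr (path 3) {suc (suc zero)})
  backward zero             (suc (suc zero)) (inj₁ ())
  backward zero             (suc (suc zero)) (inj₂ ())
  backward (suc (suc zero)) zero             (inj₁ ())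
  backward (suc (suc zero)) zero             (inj₂ ())

-- Case distinction on the order of the graph, and the characterisation.

dominating-path⇒1⊎3 : ∀ m k G → Connected G → k ≥ 1 → D k G ≅ ⟦ path (suc (suc m)) ⟧ →
                      suc (suc m) ≡ 1 ⊎ suc (suc m) ≡ 3
dominating-path⇒1⊎3 m k G@record { order-nonZero = order-nonZero } connected k≥1 iso =
  go (FiniteGraph.order G) refl order-nonZero
  where
  same-size : Inverse (Graph.vertices (D k G)) (≡.setoid (Fin n)) → suc (suc m) ≡ n
  same-size = ↔⇒≡ ∘ inverse (inverse-sym (_≅_.bijection iso))

  go : ∀ n → FiniteGraph.order G ≡ n → .(NonZero n) → suc (suc m) ≡ 1 ⊎ suc (suc m) ≡ 3
  -- The equation obtained is absurd for a path on at least two vertices, but it already has the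
  -- form of the left alternative.
  go 1 order≡1 _ = inj₁ (same-size (order-1-vertices k G order≡1 k≥1))
  go (suc (suc n)) order≡n _ with ≤-<-connex (FiniteGraph.order G) k
    | connected⇒noIsolated G connected (subst (2 ≤_) (sym order≡n) (s≤s (s≤s z≤n)))
  ... | inj₂ k<order | noIsolated =
    ⊥-elim (k<order-impossible k G noIsolated m iso k<order)
  go 2 order≡2 _ | inj₁ order≤k | noIsolated =
    inj₂ (same-size (order-2-vertices k G noIsolated order≡2 (subst (_≤ k) order≡2 order≤k)))
  go (suc (suc (suc n))) order≡n _ | inj₁ order≤k | noIsolated
    with a , b , c , a≢b , a≢c , b≢c ← three-distinct (subst (3 ≤_) (sym order≡n) (s≤s (s≤s (s≤s z≤n)))) =
    ⊥-elim (no-three-vertices k G noIsolated m iso order≤k a≢b a≢c b≢c)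

proposition4p3 : (m : ℕ) .{{_ : NonZero m}} →
    (∃[ G ] ∃[ k ] (Connected G × k ≥ 1 × D k G ≅ ⟦ path m ⟧)) ⇔ (m ≡ 1 ⊎ m ≡ 3)
proposition4p3 m = mk⇔ (forward m)
  λ { (inj₁ refl) → path 1 , 1 , path-1-connected , ≤-refl , D₁K₁≅P₁
    ; (inj₂ refl) → path 2 , 2 , path-2-connected , s≤s z≤n , D₂K₂≅P₃ }
  where
  forward : ∀ m .{{_ : NonZero m}} →
            ∃[ G ] ∃[ k ] (Connected G × k ≥ 1 × D k G ≅ ⟦ path m ⟧) → m ≡ 1 ⊎ m ≡ 3
  forward 1             _                              = inj₁ refl
  forward (suc (suc m)) (G , k , connected , k≥1 , iso) = dominating-path⇒1⊎3 m k G connected k≥1 iso
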